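{- Every closed formula $\varphi\in\mathrm{cHML}^d$ is completely monitorable for satisfactions, and every closed formula $\varphi\in\mathrm{sHML}^d$ is completely monitorable for violations.
   Context: **Data and traces.** Fix a countably infinite set $\mathbb{D}$ (data values) whose only predicate is equality, which is decidable. $\mathrm{Trc}=\mathbb{D}^\omega$ is the set of traces, $\mathbb{D}^*$ the set of finite traces. **Logic $\mu\mathrm{HML}^d$.** Let $\mathrm{DVar}$ and $\mathrm{FVar}$ be countably infinite sets of data variables $x$ and recursion variables $X$; $\star\notin\mathrm{DVar}$ is a placeholder for the current data value. Constraint expressions: $b::=\mathsf{true}\mid e=f\mid\neg b\mid b\wedge b$, with $e,f\in\mathrm{DVar}\cup\{\star\}$. Formulae: $\varphi::=\mathsf{tt}\mid\mathsf{ff}\mid\langle b\rangle\varphi\mid[b]\varphi\mid\exists x.\varphi\mid\forall x.\varphi\mid\varphi\vee\varphi\mid\varphi\wedge\varphi\mid\min X.\varphi\mid\max X.\varphi\mid X$. A data environment $\delta$ is a partial function $\mathrm{DVar}\rightharpoonup\mathbb{D}$ with finite domain; a data interpretation $F$ maps data environments to subsets of $\mathrm{Trc}$, ordered by $F\sqsubseteq G$ iff $F(\delta)\subseteq G(\delta)$ for all $\delta$; a trace environment $\rho$ maps recursion variables to data interpretations. Semantics $[\![\varphi,\rho,\delta]\!]\subseteq\mathrm{Trc}$ (with $\delta$ defined on the free data variables of $\varphi$): $\mathsf{tt}\mapsto\mathrm{Trc}$; $\mathsf{ff}\mapsto\varnothing$; $[\![X,\rho,\delta]\!]=\rho(X)(\delta)$;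 $[\![\langle b\rangle\varphi,\rho,\delta]\!]=\{du\mid b\text{ true under }\delta[\star\mapsto d]\text{ and }u\in[\![\varphi,\rho,\delta]\!]\}$; $[\![[b]\varphi,\rho,\delta]\!]=\{du\mid b\text{ true under }\delta[\star\mapsto d]\text{ implies }u\in[\![\varphi,\rho,\delta]\!]\}$; $[\![\exists x.\varphi,\rho,\delta]\!]=\bigcup_{d\in\mathbb{D}}[\![\varphi,\rho,\delta[x\mapsto d]]\!]$; $[\![\forall x.\varphi,\rho,\delta]\!]=\bigcap_{d\in\mathbb{D}}[\![\varphi,\rho,\delta[x\mapsto d]]\!]$; $\vee,\wedge$ are union, intersection; $[\![\min X.\varphi,\rho,\delta]\!]$ (resp. $\max$) is the value at $\delta$ of the $\sqsubseteq$-least (resp. greatest) fixed point of $F\mapsto\lambda\delta'.[\![\varphi,\rho[X\mapsto F],\delta']\!]$. For closed $\varphi$ write $[\![\varphi]\!]$. Standing assumption: each occurrence of a recursion variable is in the scope of a modality inside its defining fixed-point formula. **Fragments.** $\mathrm{cHML}^d$: $\varphi::=\mathsf{tt}\mid\langle b\rangle\varphi\mid\exists x.\varphi\mid\varphi\vee\varphi\mid\varphi\wedge\varphi\mid\min X.\varphi\mid X$. $\mathrm{sHML}^d$: $\varphi::=\mathsf{ff}\mid[b]\varphi\mid\forall x.\varphi\mid\varphi\vee\varphi\mid\varphi\wedge\varphi\mid\max X.\varphi\mid X$. **Monitors.** A monitor is an object $m$ with predicates $\mathbf{acc}(m,w)$, $\mathbf{rej}(m,w)$ on $w\in\mathbb{D}^*$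 such that no $w$ satisfies both, and both are preserved when $w$ is extended to a longer finite trace. For $t\in\mathrm{Trc}$, $\mathbf{acc}(m,t)$ (resp. $\mathbf{rej}(m,t)$) holds iff it holds for some finite prefix of $t$. A formula $\varphi$ is completely monitorable for satisfactions if there is a monitor $m$ such that for all $t\in\mathrm{Trc}$, $\mathbf{acc}(m,t)\Leftrightarrow t\in[\![\varphi]\!]$; it is completely monitorable for violations if there is a monitor $m$ such that for all $t$, $\mathbf{rej}(m,t)\Leftrightarrow t\notin[\![\varphi]\!]$. -}

module Defs where

open import Axiom.ExcludedMiddle using (ExcludedMiddle)
open import Data.Empty using (⊥)
open import Data.List.Base using (List; []; _∷_; _++_; applyUpTo)
open import Data.List.Membership.Propositional using (_∈_)
open import Data.List.Relation.Unary.Any using (here; there)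
open import Data.Maybe.Base using (Maybe; just; nothing)
open import Data.Nat.Base using (ℕ; suc)
import Data.Nat.Properties as ℕ
open import Data.Product.Base using (Σ; ∃; _×_; _,_)
open import Data.Sum.Base using (_⊎_)
open import Data.Unit.Base using (⊤)
open import Function.Base using (_∘_)
open import Function.Bundles using (_↔_; _⇔_)
open import Function.Properties.Inverse using (↔⇒↣)
open import Level using (0ℓ) renaming (suc to lsuc)
open import Relation.Binary.Definitions using (DecidableEquality)
open import Relation.Binary.PropositionalEquality.Core using (_≡_; _≢_)
open import Relation.Nullary.Decidable using (True; yes; no; via-injection)
open import Relation.Nullary.Negation.Core using (¬_)
open import Relation.Unary using (Pred; _⊆_)

-- The mathematics is classical.  Excluded middle is also what makes the
-- subsets of a set closed under impredicative definitions: `Holds` below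
-- resizes the large proposition "t lies in the least fixed point" to Set.

module Logic
  (em : ExcludedMiddle (lsuc 0ℓ))
  (𝔻 DVar FVar : Set)
  (DVar↔ℕ : DVar ↔ ℕ) (FVar↔ℕ : FVar ↔ ℕ)
  where

  Holds : Set₁ → Set
  Holds P = True (em {P})

  _≟ᵈ_ : DecidableEquality DVar
  _≟ᵈ_ = via-injection (↔⇒↣ DVar↔ℕ) ℕ._≟_

  _≟ᶠ_ : DecidableEquality FVar
  _≟ᶠ_ = via-injection (↔⇒↣ FVar↔ℕ) ℕ._≟_

  Trc : Set
  Trc = ℕ → 𝔻

  data Expr : Set where
    ⋆   : Expr
    dat : DVar → Expr

  infix  8 _≐_
  infixr 7 _&_

  data Constraint : Set where
    true : Constraint
    _≐_  : Expr → Expr → Constraint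
    neg  : Constraint → Constraint
    _&_  : Constraint → Constraint → Constraint

  infixr 7 ⟨_⟩_ [_]_
  infixr 6 _∧_
  infixr 5 _∨_

  data Formula : Set where
    tt ff     : Formula
    ⟨_⟩_ [_]_ : Constraint → Formula → Formula
    ex all    : DVar → Formula → Formula
    _∨_ _∧_   : Formula → Formula → Formula
    min max   : FVar → Formula → Formula
    var       : FVar → Formula

  data FreeInConstraint (x : DVar) : Constraint → Set where
    ≐ˡ  : ∀ {f} → FreeInConstraint x (dat x ≐ f)
    ≐ʳ  : ∀ {e} → FreeInConstraint x (e ≐ dat x)
    neg : ∀ {b} → FreeInConstraint x b → FreeInConstraint x (neg b)
    &ˡ  : ∀ {b c} → FreeInConstraint x b → FreeInConstraint x (b & c)
    &ʳ  : ∀ {b c} → FreeInConstraint x c → FreeInConstraint x (b & c)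

  data FreeDVar (x : DVar) : Formula → Set where
    ⟨⟩ᵇ : ∀ {b φ} → FreeInConstraint x b → FreeDVar x (⟨ b ⟩ φ)
    ⟨⟩  : ∀ {b φ} → FreeDVar x φ → FreeDVar x (⟨ b ⟩ φ)
    []ᵇ : ∀ {b φ} → FreeInConstraint x b → FreeDVar x ([ b ] φ)
    []  : ∀ {b φ} → FreeDVar x φ → FreeDVar x ([ b ] φ)
    ex  : ∀ {y φ} → x ≢ y → FreeDVar x φ → FreeDVar x (ex y φ)
    all : ∀ {y φ} → x ≢ y → FreeDVar x φ → FreeDVar x (all y φ)
    ∨ˡ  : ∀ {φ ψ} → FreeDVar x φ → FreeDVar x (φ ∨ ψ)
    ∨ʳ  : ∀ {φ ψ} → FreeDVar x ψ → FreeDVar x (φ ∨ ψ)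
    ∧ˡ  : ∀ {φ ψ} → FreeDVar x φ → FreeDVar x (φ ∧ ψ)
    ∧ʳ  : ∀ {φ ψ} → FreeDVar x ψ → FreeDVar x (φ ∧ ψ)
    min : ∀ {Y φ} → FreeDVar x φ → FreeDVar x (min Y φ)
    max : ∀ {Y φ} → FreeDVar x φ → FreeDVar x (max Y φ)

  data FreeFVar (X : FVar) : Formula → Set where
    ⟨⟩  : ∀ {b φ} → FreeFVar X φ → FreeFVar X (⟨ b ⟩ φ)
    []  : ∀ {b φ} → FreeFVar X φ → FreeFVar X ([ b ] φ)
    ex  : ∀ {y φ} → FreeFVar X φ → FreeFVar X (ex y φ)
    all : ∀ {y φ} → FreeFVar X φ → FreeFVar X (all y φ)
    ∨ˡ  : ∀ {φ ψ} → FreeFVar X φ → FreeFVar X (φ ∨ ψ)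
    ∨ʳ  : ∀ {φ ψ} → FreeFVar X ψ → FreeFVar X (φ ∨ ψ)
    ∧ˡ  : ∀ {φ ψ} → FreeFVar X φ → FreeFVar X (φ ∧ ψ)
    ∧ʳ  : ∀ {φ ψ} → FreeFVar X ψ → FreeFVar X (φ ∧ ψ)
    min : ∀ {Y φ} → X ≢ Y → FreeFVar X φ → FreeFVar X (min Y φ)
    max : ∀ {Y φ} → X ≢ Y → FreeFVar X φ → FreeFVar X (max Y φ)
    var : FreeFVar X (var X)

  Closed : Formula → Set
  Closed φ = (∀ x → ¬ FreeDVar x φ) × (∀ X → ¬ FreeFVar X φ)

  -- Every free occurrence of X is in the scope of a modality.
  GuardedIn : FVar → Formula → Set
  GuardedIn X tt        = ⊤
  GuardedIn X ff        = ⊤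
  GuardedIn X (⟨ b ⟩ φ) = ⊤
  GuardedIn X ([ b ] φ) = ⊤
  GuardedIn X (ex x φ)  = GuardedIn X φ
  GuardedIn X (all x φ) = GuardedIn X φ
  GuardedIn X (φ ∨ ψ)   = GuardedIn X φ × GuardedIn X ψ
  GuardedIn X (φ ∧ ψ)   = GuardedIn X φ × GuardedIn X ψ
  GuardedIn X (min Y φ) = X ≡ Y ⊎ GuardedIn X φ
  GuardedIn X (max Y φ) = X ≡ Y ⊎ GuardedIn X φ
  GuardedIn X (var Y)   = X ≢ Y

  Guarded : Formula → Set
  Guarded tt        = ⊤
  Guarded ff        = ⊤
  Guarded (⟨ b ⟩ φ) = Guarded φ
  Guarded ([ b ] φ) = Guarded φ
  Guarded (ex x φ)  = Guarded φ
  Guarded (all x φ) = Guarded φ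
  Guarded (φ ∨ ψ)   = Guarded φ × Guarded ψ
  Guarded (φ ∧ ψ)   = Guarded φ × Guarded ψ
  Guarded (min X φ) = GuardedIn X φ × Guarded φ
  Guarded (max X φ) = GuardedIn X φ × Guarded φ
  Guarded (var X)   = ⊤

  data cHML : Formula → Set where
    tt  : cHML tt
    ⟨⟩  : ∀ {b φ} → cHML φ → cHML (⟨ b ⟩ φ)
    ex  : ∀ {x φ} → cHML φ → cHML (ex x φ)
    _∨_ : ∀ {φ ψ} → cHML φ → cHML ψ → cHML (φ ∨ ψ)
    _∧_ : ∀ {φ ψ} → cHML φ → cHML ψ → cHML (φ ∧ ψ)
    min : ∀ {X φ} → cHML φ → cHML (min X φ)
    var : ∀ {X} → cHML (var X)

  data sHML : Formula → Set where
    ff  : sHML ff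
    []  : ∀ {b φ} → sHML φ → sHML ([ b ] φ)
    all : ∀ {x φ} → sHML φ → sHML (all x φ)
    _∨_ : ∀ {φ ψ} → sHML φ → sHML ψ → sHML (φ ∨ ψ)
    _∧_ : ∀ {φ ψ} → sHML φ → sHML ψ → sHML (φ ∧ ψ)
    max : ∀ {X φ} → sHML φ → sHML (max X φ)
    var : ∀ {X} → sHML (var X)

  record DEnv : Set where
    field
      lookup : DVar → Maybe 𝔻
      finite : ∃ λ (xs : List DVar) → ∀ x d → lookup x ≡ just d → x ∈ xs

  open DEnv public

  ∅ᵈ : DEnv
  ∅ᵈ = record { lookup = λ _ → nothing ; finite = [] , λ _ _ () }

  _[_↦_]ᵈ : DEnv → DVar → 𝔻 → DEnv
  δ [ x ↦ d ]ᵈ = record { lookup = lookup′ ; finite = finite′ (finite δ) }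
    where
    lookup′ : DVar → Maybe 𝔻
    lookup′ y with y ≟ᵈ x
    ... | yes _ = just d
    ... | no  _ = lookup δ y

    finite′ : ∃ (λ (xs : List DVar) → ∀ y v → lookup δ y ≡ just v → y ∈ xs) →
              ∃ (λ (xs : List DVar) → ∀ y v → lookup′ y ≡ just v → y ∈ xs)
    finite′ (xs , dom) = x ∷ xs , dom′
      where
      dom′ : ∀ y v → lookup′ y ≡ just v → y ∈ x ∷ xs
      dom′ y v eq with y ≟ᵈ x
      ... | yes y≡x = here y≡x
      ... | no  _   = there (dom y v eq)

  Interp : Set₁
  Interp = DEnv → Pred Trc 0ℓ

  infix 4 _⊑_ _≈_

  _⊑_ : Interp → Interp → Set
  F ⊑ G = ∀ δ → F δ ⊆ G δ

  _≈_ : Interp → Interp → Set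
  F ≈ G = F ⊑ G × G ⊑ F

  IsLeastFixedPoint : (Interp → Interp) → Interp → Set₁
  IsLeastFixedPoint Φ F = Φ F ≈ F × (∀ G → Φ G ≈ G → F ⊑ G)

  IsGreatestFixedPoint : (Interp → Interp) → Interp → Set₁
  IsGreatestFixedPoint Φ F = Φ F ≈ F × (∀ G → Φ G ≈ G → G ⊑ F)

  TEnv : Set₁
  TEnv = FVar → Interp

  ∅ᵗ : TEnv
  ∅ᵗ _ _ _ = ⊥

  _[_↦_]ᵗ : TEnv → FVar → Interp → TEnv
  (ρ [ X ↦ F ]ᵗ) Y with Y ≟ᶠ X
  ... | yes _ = F
  ... | no  _ = ρ Y

  -- The value of an expression under δ[⋆ ↦ d].
  value : DEnv → 𝔻 → Expr → Maybe 𝔻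
  value δ d ⋆       = just d
  value δ d (dat x) = lookup δ x

  -- Truth under δ[⋆ ↦ d].  An equation with an undefined side counts as
  -- false; this never matters when δ is defined on the free variables.
  Sat : Constraint → DEnv → 𝔻 → Set
  Sat true    δ d = ⊤
  Sat (e ≐ f) δ d = ∃ λ v → value δ d e ≡ just v × value δ d f ≡ just v
  Sat (neg b) δ d = ¬ Sat b δ d
  Sat (b & c) δ d = Sat b δ d × Sat c δ d

  -- A trace t is du with d = t 0 and u = t ∘ suc.  The extremal fixed points
  -- are given by definite description; they exist by Knaster–Tarski, since
  -- formulae are monotone in their recursion variables.
  ⟦_⟧ : Formula → TEnv → Interp
  ⟦ tt ⟧      ρ δ t = ⊤
  ⟦ ff ⟧      ρ δ t = ⊥
  ⟦ ⟨ b ⟩ φ ⟧ ρ δ t = Sat b δ (t 0) × ⟦ φ ⟧ ρ δ (t ∘ suc)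
  ⟦ [ b ] φ ⟧ ρ δ t = Sat b δ (t 0) → ⟦ φ ⟧ ρ δ (t ∘ suc)
  ⟦ ex x φ ⟧  ρ δ t = ∃ λ d → ⟦ φ ⟧ ρ (δ [ x ↦ d ]ᵈ) t
  ⟦ all x φ ⟧ ρ δ t = ∀ d → ⟦ φ ⟧ ρ (δ [ x ↦ d ]ᵈ) t
  ⟦ φ ∨ ψ ⟧   ρ δ t = ⟦ φ ⟧ ρ δ t ⊎ ⟦ ψ ⟧ ρ δ t
  ⟦ φ ∧ ψ ⟧   ρ δ t = ⟦ φ ⟧ ρ δ t × ⟦ ψ ⟧ ρ δ t
  ⟦ min X φ ⟧ ρ δ t = Holds (∃ λ F →
    IsLeastFixedPoint (λ G → ⟦ φ ⟧ (ρ [ X ↦ G ]ᵗ)) F × F δ t)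
  ⟦ max X φ ⟧ ρ δ t = Holds (∃ λ F →
    IsGreatestFixedPoint (λ G → ⟦ φ ⟧ (ρ [ X ↦ G ]ᵗ)) F × F δ t)
  ⟦ var X ⟧   ρ δ t = ρ X δ t

  -- For closed φ; the choice of environments is then immaterial.
  ⟦_⟧₀ : Formula → Pred Trc 0ℓ
  ⟦ φ ⟧₀ = ⟦ φ ⟧ ∅ᵗ ∅ᵈ

  record Monitor : Set₁ where
    field
      acc rej    : Pred (List 𝔻) 0ℓ
      disjoint   : ∀ w → ¬ (acc w × rej w)
      acc-extend : ∀ w v → acc w → acc (w ++ v)
      rej-extend : ∀ w v → rej w → rej (w ++ v)

    -- applyUpTo t n is the prefix of t of length n.
    accᵗ rejᵗ : Pred Trc 0ℓ
    accᵗ t = ∃ λ n → acc (applyUpTo t n)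
    rejᵗ t = ∃ λ n → rej (applyUpTo t n)

  open Monitor public using (accᵗ; rejᵗ)

  CompletelyMonitorableForSatisfactions : Formula → Set₁
  CompletelyMonitorableForSatisfactions φ =
    Σ Monitor λ m → ∀ t → accᵗ m t ⇔ ⟦ φ ⟧₀ t

  CompletelyMonitorableForViolations : Formula → Set₁
  CompletelyMonitorableForViolations φ =
    Σ Monitor λ m → ∀ t → rejᵗ m t ⇔ (¬ ⟦ φ ⟧₀ t)

{-# OPTIONS --safe #-}

-- Satisfactions of φ are completely monitorable as soon as ⟦ φ ⟧₀ is open in
-- the prefix topology on traces: accept w when all traces extending w satisfy
-- φ.  Dually, violations are completely monitorable as soon as ⟦ φ ⟧₀ is
-- closed.  In cHML the only infinitary operations are unions (ex) and least
-- fixed points.  The latter stay open because, if F is the least fixed point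
-- of a monotone Φ that preserves openness, then Φ (interior F) is an open
-- subset of Φ F = F, so interior F is a prefixed point and contains F.
-- Dually, greatest fixed points in sHML are closed.

module Submission where

open import Defs
open import Axiom.ExcludedMiddle using (ExcludedMiddle)
open import Data.Empty using (⊥)
open import Data.List.Base using (List; []; _∷_; _++_; applyUpTo)
open import Data.List.Properties using (++-assoc; ++-identityʳ; ∷-injective)
open import Data.Nat.Base using (ℕ; zero; suc; _<_; _≤_; _⊔_; z<s; s<s)
open import Data.Nat.Properties using (<-≤-trans; m≤m⊔n; m≤n⊔m)
open import Data.Product.Base using (∃; _×_; _,_; proj₁; proj₂)
open import Data.Sum.Base as Sum using (inj₁; inj₂)
open import Function.Base using (_∘_)
open import Function.Bundles using (_↔_; mk⇔)
open import Level using (0ℓ; lift; lower) renaming (suc to lsuc)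
open import Relation.Binary.PropositionalEquality using (_≡_; refl; sym; trans; subst)
open import Relation.Nullary.Decidable
  using (yes; no; map′; toWitness; fromWitness; decidable-stable)
open import Relation.Unary using (Pred; _⊆_; _∪_; _∩_; ∁)

module Monitorability
  (em : ExcludedMiddle (lsuc 0ℓ))
  (𝔻 DVar FVar : Set)
  (DVar↔ℕ : DVar ↔ ℕ) (FVar↔ℕ : FVar ↔ ℕ)
  where

  open Logic em 𝔻 DVar FVar DVar↔ℕ FVar↔ℕ

  em₀ : ExcludedMiddle 0ℓ
  em₀ = map′ lower lift em

  -- The prefix topology

  infix 4 _≈[_]_

  _≈[_]_ : Trc → ℕ → Trc → Set
  t ≈[ n ] u = ∀ i → i < n → t i ≡ u i

  ≈[]-weaken : ∀ {m n t u} → m ≤ n → t ≈[ n ] u → t ≈[ m ] u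
  ≈[]-weaken m≤n t≈u i i<m = t≈u i (<-≤-trans i<m m≤n)

  ≈[]-tail : ∀ {n t u} → t ≈[ suc n ] u → t ∘ suc ≈[ n ] u ∘ suc
  ≈[]-tail t≈u i i<n = t≈u (suc i) (s<s i<n)

  interior closure : Pred Trc 0ℓ → Pred Trc 0ℓ
  interior S t = ∃ λ n → ∀ u → t ≈[ n ] u → S u
  closure  S t = ∀ n → ∃ λ u → t ≈[ n ] u × S u

  IsOpen IsClosed : Pred Trc 0ℓ → Set
  IsOpen   S = S ⊆ interior S
  IsClosed S = closure S ⊆ S

  interior-⊆ : ∀ {S} → interior S ⊆ S
  interior-⊆ (_ , nbhd) = nbhd _ λ _ _ → refl

  interior-mono : ∀ {S T} → S ⊆ T → interior S ⊆ interior T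
  interior-mono S⊆T (n , nbhd) = n , λ u t≈u → S⊆T (nbhd u t≈u)

  -- The same `n` serves every `u` in the neighbourhood, since agreement below `n` is transitive.
  interior-open : ∀ {S} → IsOpen (interior S)
  interior-open (n , nbhd) =
    n , λ u t≈u → n , λ v u≈v → nbhd v λ i i<n → trans (t≈u i i<n) (u≈v i i<n)

  ⊆-closure : ∀ {S} → S ⊆ closure S
  ⊆-closure St n = _ , (λ _ _ → refl) , St

  closure-mono : ∀ {S T} → S ⊆ T → closure S ⊆ closure T
  closure-mono S⊆T cl n with cl n
  ... | u , t≈u , Su = u , t≈u , S⊆T Su

  closure-closed : ∀ {S} → IsClosed (closure S)
  closure-closed cl n with cl n
  ... | u , t≈u , clu with clu n
  ...   | v , u≈v , Sv = v , (λ i i<n → trans (t≈u i i<n) (u≈v i i<n)) , Sv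

  ∪-open : ∀ {S T} → IsOpen S → IsOpen T → IsOpen (S ∪ T)
  ∪-open open-S open-T (inj₁ St) = interior-mono inj₁ (open-S St)
  ∪-open open-S open-T (inj₂ Tt) = interior-mono inj₂ (open-T Tt)

  ∩-open : ∀ {S T} → IsOpen S → IsOpen T → IsOpen (S ∩ T)
  ∩-open open-S open-T (St , Tt) with open-S St | open-T Tt
  ... | m , nbhd-S | n , nbhd-T = m ⊔ n , λ u t≈u →
    nbhd-S u (≈[]-weaken (m≤m⊔n m n) t≈u) , nbhd-T u (≈[]-weaken (m≤n⊔m m n) t≈u)

  -- Classical contraposition: if every neighbourhood of `t` met `S`, then `t` would lie in the
  -- closure of `S`.
  ∁-open : ∀ {S} → IsClosed S → IsOpen (∁ S)
  ∁-open {S} closed-S {t} ¬St = decidable-stable em₀ λ ¬int →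
    ¬St (closed-S λ n → decidable-stable em₀ λ ¬cl →
      ¬int (n , λ u t≈u Su → ¬cl (u , t≈u , Su)))

  -- The approximants of a point in the closure may alternate between `S` and `T`, so the argument
  -- is by contradiction: outside both sets, some prefix of length `m` excludes both, yet an
  -- approximant sharing that prefix lies in one of them.
  ∪-closed : ∀ {S T} → IsClosed S → IsClosed T → IsClosed (S ∪ T)
  ∪-closed closed-S closed-T cl = decidable-stable em₀ λ ¬S∪T →
    let m , nbhd = ∩-open (∁-open closed-S) (∁-open closed-T)
                     (¬S∪T ∘ inj₁ , ¬S∪T ∘ inj₂)
        u , t≈u , S∪Tu = cl m
        ¬Su , ¬Tu = nbhd u t≈u
    in Sum.[ ¬Su , ¬Tu ] S∪Tu

  ∩-closed : ∀ {S T} → IsClosed S → IsClosed T → IsClosed (S ∩ T)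
  ∩-closed closed-S closed-T cl =
    closed-S (closure-mono proj₁ cl) , closed-T (closure-mono proj₂ cl)

  -- Extremal fixed points

  Monotone : (Interp → Interp) → Set₁
  Monotone Φ = ∀ {F G} → F ⊑ G → Φ F ⊑ Φ G

  -- The Knaster-Tarski formulas: the intersection of all prefixed points and the union of all
  -- postfixed points. Both quantify over `Interp : Set₁`, hence `Holds`.
  lfp gfp : (Interp → Interp) → Interp
  lfp Φ δ t = Holds (∀ G → Φ G ⊑ G → G δ t)
  gfp Φ δ t = Holds (∃ λ G → G ⊑ Φ G × G δ t)

  lfp-least : ∀ {Φ G} → Φ G ⊑ G → lfp Φ ⊑ G
  lfp-least ΦG⊑G _ h = toWitness h _ ΦG⊑G

  gfp-greatest : ∀ {Φ G} → G ⊑ Φ G → G ⊑ gfp Φ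
  gfp-greatest G⊑ΦG _ Gt = fromWitness (_ , G⊑ΦG , Gt)

  lfp-prefixed : ∀ {Φ} → Monotone Φ → Φ (lfp Φ) ⊑ lfp Φ
  lfp-prefixed mono δ h = fromWitness λ G ΦG⊑G →
    ΦG⊑G δ (mono (lfp-least ΦG⊑G) δ h)

  gfp-postfixed : ∀ {Φ} → Monotone Φ → gfp Φ ⊑ Φ (gfp Φ)
  gfp-postfixed mono δ h with toWitness h
  ... | G , G⊑ΦG , Gt = mono (gfp-greatest G⊑ΦG) δ (G⊑ΦG δ Gt)

  lfp-isLeastFixedPoint : ∀ {Φ} → Monotone Φ → IsLeastFixedPoint Φ (lfp Φ)
  lfp-isLeastFixedPoint mono =
    (lfp-prefixed mono , lfp-least (mono (lfp-prefixed mono))) ,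
    λ G ΦG≈G → lfp-least (proj₁ ΦG≈G)

  gfp-isGreatestFixedPoint : ∀ {Φ} → Monotone Φ → IsGreatestFixedPoint Φ (gfp Φ)
  gfp-isGreatestFixedPoint mono =
    (gfp-greatest (mono (gfp-postfixed mono)) , gfp-postfixed mono) ,
    λ G ΦG≈G → gfp-greatest (proj₂ ΦG≈G)

  -- `lfp Ψ` is a prefixed point of `Φ`, because `Φ (lfp Ψ) ⊑ Ψ (lfp Ψ) ⊑ lfp Ψ`.
  lfp-mono : ∀ {Φ Ψ} → Monotone Ψ → (∀ F → Φ F ⊑ Ψ F) → lfp Φ ⊑ lfp Ψ
  lfp-mono mono Φ⊑Ψ = lfp-least λ δ → lfp-prefixed mono δ ∘ Φ⊑Ψ _ δ

  gfp-mono : ∀ {Φ Ψ} → Monotone Φ → (∀ F → Φ F ⊑ Ψ F) → gfp Φ ⊑ gfp Ψ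
  gfp-mono mono Φ⊑Ψ = gfp-greatest λ δ → Φ⊑Ψ _ δ ∘ gfp-postfixed mono δ

  -- Trades the definite description in `⟦_⟧`, which compares with fixed points only, for `lfp`,
  -- which lies below every prefixed point.
  theLeast≈lfp : ∀ {Φ} → Monotone Φ →
    (λ δ t → Holds (∃ λ F → IsLeastFixedPoint Φ F × F δ t)) ≈ lfp Φ
  theLeast≈lfp {Φ} mono = to , λ δ h → fromWitness (_ , lfp-isLeastFixedPoint mono , h)
    where
    to : (λ δ t → Holds (∃ λ F → IsLeastFixedPoint Φ F × F δ t)) ⊑ lfp Φ
    to δ h with toWitness h
    ... | F , (_ , least) , Ft = least _ (proj₁ (lfp-isLeastFixedPoint mono)) δ Ft

  theGreatest≈gfp : ∀ {Φ} → Monotone Φ →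
    (λ δ t → Holds (∃ λ F → IsGreatestFixedPoint Φ F × F δ t)) ≈ gfp Φ
  theGreatest≈gfp {Φ} mono = to , λ δ h → fromWitness (_ , gfp-isGreatestFixedPoint mono , h)
    where
    to : (λ δ t → Holds (∃ λ F → IsGreatestFixedPoint Φ F × F δ t)) ⊑ gfp Φ
    to δ h with toWitness h
    ... | F , (ΦF≈F , _) , Ft = gfp-greatest (proj₂ ΦF≈F) δ Ft

  lfp-open : ∀ {Φ} → Monotone Φ →
    (∀ {F} → (∀ δ → IsOpen (F δ)) → ∀ δ → IsOpen (Φ F δ)) →
    ∀ δ → IsOpen (lfp Φ δ)
  lfp-open mono Φ-open = lfp-least λ δ →
    interior-mono (λ h → lfp-prefixed mono δ (mono (λ _ → interior-⊆) δ h)) ∘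
    Φ-open (λ _ → interior-open) δ

  gfp-closed : ∀ {Φ} → Monotone Φ →
    (∀ {F} → (∀ δ → IsClosed (F δ)) → ∀ δ → IsClosed (Φ F δ)) →
    ∀ δ → IsClosed (gfp Φ δ)
  -- With `F = gfp Φ`, the closure of `F` is a postfixed point: `F ⊑ Φ F ⊑ Φ (closure F)`, and the
  -- last set is closed, so it contains the closure of `F`.
  gfp-closed mono Φ-closed = gfp-greatest λ δ →
    Φ-closed (λ _ → closure-closed) δ ∘
    closure-mono (λ h → mono (λ _ → ⊆-closure) δ (gfp-postfixed mono δ h))

  -- Semantics

  -- Does the case split of an environment update once, for inclusion, openness and closedness
  -- alike.
  []ᵗ-lift₂ : ∀ {ℓ} (R : Interp → Interp → Set ℓ) {ρ σ} X {F G} →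
    (∀ Y → R (ρ Y) (σ Y)) → R F G → ∀ Y → R ((ρ [ X ↦ F ]ᵗ) Y) ((σ [ X ↦ G ]ᵗ) Y)
  []ᵗ-lift₂ R X Rρσ RFG Y with Y ≟ᶠ X
  ... | yes _ = RFG
  ... | no  _ = Rρσ Y

  []ᵗ-lift : ∀ {ℓ} (P : Interp → Set ℓ) {ρ} X {F} →
    (∀ Y → P (ρ Y)) → P F → ∀ Y → P ((ρ [ X ↦ F ]ᵗ) Y)
  []ᵗ-lift P {ρ} X {F} = []ᵗ-lift₂ (λ G _ → P G) {ρ} {ρ} X {F} {F}

  -- Mutual with `body-mono`: comparing two fixed points first requires that both bodies be
  -- monotone, so that both descriptions can be replaced by `lfp` or `gfp`.
  ⟦⟧-mono : ∀ φ {ρ σ} → (∀ X → ρ X ⊑ σ X) → ⟦ φ ⟧ ρ ⊑ ⟦ φ ⟧ σ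
  body-mono : ∀ φ ρ X → Monotone (λ F → ⟦ φ ⟧ (ρ [ X ↦ F ]ᵗ))

  ⟦⟧-mono tt        ρ⊑σ δ h        = h
  ⟦⟧-mono (⟨ b ⟩ φ) ρ⊑σ δ (s , h)  = s , ⟦⟧-mono φ ρ⊑σ δ h
  ⟦⟧-mono ([ b ] φ) ρ⊑σ δ h s      = ⟦⟧-mono φ ρ⊑σ δ (h s)
  ⟦⟧-mono (ex x φ)  ρ⊑σ δ (d , h)  = d , ⟦⟧-mono φ ρ⊑σ _ h
  ⟦⟧-mono (all x φ) ρ⊑σ δ h d      = ⟦⟧-mono φ ρ⊑σ _ (h d)
  ⟦⟧-mono (φ ∨ ψ)   ρ⊑σ δ          = Sum.map (⟦⟧-mono φ ρ⊑σ δ) (⟦⟧-mono ψ ρ⊑σ δ)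
  ⟦⟧-mono (φ ∧ ψ)   ρ⊑σ δ (h , h′) = ⟦⟧-mono φ ρ⊑σ δ h , ⟦⟧-mono ψ ρ⊑σ δ h′
  ⟦⟧-mono (min X φ) {ρ} {σ} ρ⊑σ δ  =
    proj₂ (theLeast≈lfp (body-mono φ σ X)) δ ∘
    lfp-mono (body-mono φ σ X) (λ F → ⟦⟧-mono φ ([]ᵗ-lift₂ _⊑_ {ρ} {σ} X ρ⊑σ λ _ h → h)) δ ∘
    proj₁ (theLeast≈lfp (body-mono φ ρ X)) δ
  ⟦⟧-mono (max X φ) {ρ} {σ} ρ⊑σ δ  =
    proj₂ (theGreatest≈gfp (body-mono φ σ X)) δ ∘
    gfp-mono (body-mono φ ρ X) (λ F → ⟦⟧-mono φ ([]ᵗ-lift₂ _⊑_ {ρ} {σ} X ρ⊑σ λ _ h → h)) δ ∘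
    proj₁ (theGreatest≈gfp (body-mono φ ρ X)) δ
  ⟦⟧-mono (var X)   ρ⊑σ            = ρ⊑σ X

  body-mono φ ρ X F⊑G = ⟦⟧-mono φ ([]ᵗ-lift₂ _⊑_ {ρ} {ρ} X (λ _ _ h → h) F⊑G)

  -- The induction ranges over all open `ρ` because `min` binds its variable to an arbitrary open
  -- interpretation, and over all `δ` because `ex` extends it.
  cHML-open : ∀ {φ} → cHML φ → ∀ {ρ} → (∀ X δ → IsOpen (ρ X δ)) →
    ∀ δ → IsOpen (⟦ φ ⟧ ρ δ)
  cHML-open tt      open-ρ δ _       = 0 , λ _ _ → _
  cHML-open (⟨⟩ {b} c) open-ρ δ (s , h) with cHML-open c open-ρ δ h
  -- The extra position fixes the head of the trace, so `b` reads the same data value.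
  ... | n , nbhd = suc n , λ u t≈u →
    subst (Sat b δ) (t≈u 0 z<s) s , nbhd (u ∘ suc) (≈[]-tail t≈u)
  cHML-open (ex c)  open-ρ δ (d , h) = interior-mono (d ,_) (cHML-open c open-ρ _ h)
  cHML-open (c ∨ e) open-ρ δ         = ∪-open (cHML-open c open-ρ δ) (cHML-open e open-ρ δ)
  cHML-open (c ∧ e) open-ρ δ         = ∩-open (cHML-open c open-ρ δ) (cHML-open e open-ρ δ)
  cHML-open (min {X} {φ} c) {ρ} open-ρ δ =
    interior-mono (proj₂ min≈lfp δ) ∘
    lfp-open (body-mono φ ρ X)
      (λ open-F → cHML-open c ([]ᵗ-lift (λ F → ∀ δ → IsOpen (F δ)) {ρ} X open-ρ open-F)) δ ∘
    proj₁ min≈lfp δ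
    where min≈lfp = theLeast≈lfp (body-mono φ ρ X)
  cHML-open var     open-ρ           = open-ρ _

  sHML-closed : ∀ {φ} → sHML φ → ∀ {ρ} → (∀ X δ → IsClosed (ρ X δ)) →
    ∀ δ → IsClosed (⟦ φ ⟧ ρ δ)
  sHML-closed ff      closed-ρ δ cl = proj₂ (proj₂ (cl 0))
  sHML-closed ([] {b} {φ} c) {ρ} closed-ρ δ {t} cl s = sHML-closed c closed-ρ δ tail-cl
    where
    tail-cl : closure (⟦ φ ⟧ ρ δ) (t ∘ suc)
    tail-cl n with cl (suc n)
    -- Approximating `t` one position further makes `u` share its head, so `b` holds there and `h`
    -- yields the tail.
    ... | u , t≈u , h = u ∘ suc , ≈[]-tail t≈u , h (subst (Sat b δ) (t≈u 0 z<s) s)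
  sHML-closed (all c) closed-ρ δ cl d =
    sHML-closed c closed-ρ _ (closure-mono (λ h → h d) cl)
  sHML-closed (c ∨ e) closed-ρ δ = ∪-closed (sHML-closed c closed-ρ δ) (sHML-closed e closed-ρ δ)
  sHML-closed (c ∧ e) closed-ρ δ = ∩-closed (sHML-closed c closed-ρ δ) (sHML-closed e closed-ρ δ)
  sHML-closed (max {X} {φ} c) {ρ} closed-ρ δ =
    proj₂ max≈gfp δ ∘
    gfp-closed (body-mono φ ρ X)
      (λ closed-F → sHML-closed c ([]ᵗ-lift (λ F → ∀ δ → IsClosed (F δ)) {ρ} X closed-ρ closed-F)) δ ∘
    closure-mono (proj₁ max≈gfp δ)
    where max≈gfp = theGreatest≈gfp (body-mono φ ρ X)
  sHML-closed var     closed-ρ = closed-ρ _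

  -- Monitors

  -- Mentioning a longer prefix w ++ v of t makes preservation under extension
  -- of w an instance of associativity.
  Forces : Pred Trc 0ℓ → Pred (List 𝔻) 0ℓ
  Forces S w = ∀ t n v → applyUpTo t n ≡ w ++ v → S t

  Forces-extend : ∀ {S} w v → Forces S w → Forces S (w ++ v)
  Forces-extend w v forces t n v′ eq = forces t n (v ++ v′) (trans eq (++-assoc w v v′))

  -- Both prefixes are peeled together: `n = 0` leaves no index to check, and `m = 0` with `n`
  -- positive contradicts the equation.
  applyUpTo-++⇒≈[] : ∀ {t u v} n m → applyUpTo u m ≡ applyUpTo t n ++ v → t ≈[ n ] u
  applyUpTo-++⇒≈[] (suc n) (suc m) eq zero    _         = sym (proj₁ (∷-injective eq))
  applyUpTo-++⇒≈[] (suc n) (suc m) eq (suc i) (s<s i<n) =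
    applyUpTo-++⇒≈[] n m (proj₂ (∷-injective eq)) i i<n

  forces-sound : ∀ {S t} → (∃ λ n → Forces S (applyUpTo t n)) → S t
  -- `t` itself extends its prefix, with `v` empty.
  forces-sound {t = t} (n , forces) = forces t n [] (sym (++-identityʳ _))

  forces-complete : ∀ {S} → IsOpen S → ∀ {t} → S t → ∃ λ n → Forces S (applyUpTo t n)
  forces-complete open-S St with open-S St
  ... | n , nbhd = n , λ u m v eq → nbhd u (applyUpTo-++⇒≈[] n m eq)

  open⇒satisfactions : ∀ φ → IsOpen ⟦ φ ⟧₀ → CompletelyMonitorableForSatisfactions φ
  open⇒satisfactions φ open-φ = monitor , λ t → mk⇔ forces-sound (forces-complete open-φ)
    where
    monitor : Monitor
    monitor = record
      { acc = Forces ⟦ φ ⟧₀ ; rej = λ _ → ⊥ ; disjoint = λ _ → proj₂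
      ; acc-extend = Forces-extend ; rej-extend = λ _ _ r → r }

  closed⇒violations : ∀ φ → IsClosed ⟦ φ ⟧₀ → CompletelyMonitorableForViolations φ
  closed⇒violations φ closed-φ =
    monitor , λ t → mk⇔ forces-sound (forces-complete (∁-open closed-φ))
    where
    monitor : Monitor
    monitor = record
      { acc = λ _ → ⊥ ; rej = Forces (∁ ⟦ φ ⟧₀) ; disjoint = λ _ → proj₁
      ; acc-extend = λ _ _ a → a ; rej-extend = Forces-extend }

theorem16 : (em : ExcludedMiddle (lsuc 0ℓ))
    (𝔻 DVar FVar : Set) (𝔻↔ℕ : 𝔻 ↔ ℕ) (DVar↔ℕ : DVar ↔ ℕ) (FVar↔ℕ : FVar ↔ ℕ) →
    let open Logic em 𝔻 DVar FVar DVar↔ℕ FVar↔ℕ in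
    (∀ φ → cHML φ → Closed φ → Guarded φ → CompletelyMonitorableForSatisfactions φ)
    × (∀ φ → sHML φ → Closed φ → Guarded φ → CompletelyMonitorableForViolations φ)
theorem16 em 𝔻 DVar FVar _ DVar↔ℕ FVar↔ℕ =
    -- `∅ᵗ` assigns the empty set everywhere, which is both open and closed; for closedness, any
    -- approximant would be an element of it.
    (λ φ c _ _ → open⇒satisfactions φ (cHML-open c (λ _ _ ()) ∅ᵈ))
  , (λ φ s _ _ → closed⇒violations φ (sHML-closed s (λ _ _ cl → proj₂ (proj₂ (cl 0))) ∅ᵈ))
  where
  open Logic em 𝔻 DVar FVar DVar↔ℕ FVar↔ℕ
  open Monitorability em 𝔻 DVar FVar DVar↔ℕ FVar↔ℕ
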